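{- For all 4-tuples $A,B,C\in V^4$, where $V=\{\text{marked},\text{unmarked}\}$, $$A\vee_i (B\wedge_j C)=(A\vee_i B)\wedge_j (A\vee_i C),$$ where $\vee_i$ and $\wedge_j$ are the binary operations on $V^4$ $$A\vee_i B = I\big(I^3(A)\cdot I^3(B)\big),\qquad A\wedge_j B = J^3\big(J(A)\cdot J(B)\big),$$ with $I(a,b,c,d)=(\bar{b},a,d,\bar{c})$, $J(a,b,c,d)=(\bar{c},\bar{d},a,b)$, and $\cdot$ denoting componentwise juxtaposition.
   Context: In Laws of Form (LoF) an expression takes one of two values, marked or unmarked. Crossing $x\mapsto\bar{x}$ interchanges the two values. Juxtaposition $xy$ of $x,y\in V$ is marked if at least one of $x,y$ is marked and unmarked otherwise (i.e. it is Boolean "or" with marked read as true). On 4-tuples, juxtaposition is componentwise: $(a,b,c,d)\cdot(e,f,g,h)=(ae,bf,cg,dh)$. Powers such as $I^3$ denote iterated composition of the operator with itself. -}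

module Defs where

open import Data.Vec using (Vec; []; _∷_; zipWith)
open import Function.Endo.Propositional using (_^_)

data V : Set where
  marked unmarked : V

cross : V → V
cross marked   = unmarked
cross unmarked = marked

juxtapose : V → V → V
juxtapose marked   _ = marked
juxtapose unmarked y = y

V⁴ : Set
V⁴ = Vec V 4

infixl 7 _·_
infixl 6 _∨ᵢ_ _∧ⱼ_

_·_ : V⁴ → V⁴ → V⁴
_·_ = zipWith juxtapose

I : V⁴ → V⁴
I (a ∷ b ∷ c ∷ d ∷ []) = cross b ∷ a ∷ d ∷ cross c ∷ []

J : V⁴ → V⁴
J (a ∷ b ∷ c ∷ d ∷ []) = cross c ∷ cross d ∷ a ∷ b ∷ []

-- The library's _^_ takes the underlying set as its first explicit
-- argument, so (V⁴ ^ I) 3 is the threefold composite I ∘ I ∘ I.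

_∨ᵢ_ : V⁴ → V⁴ → V⁴
A ∨ᵢ B = I ((V⁴ ^ I) 3 A · (V⁴ ^ I) 3 B)

_∧ⱼ_ : V⁴ → V⁴ → V⁴
A ∧ⱼ B = (V⁴ ^ J) 3 (J A · J B)

{-# OPTIONS --safe #-}

-- Since I² and J² are both componentwise crossing, ∨ᵢ acts on the four
-- coordinates as (and, or, or, and) and ∧ⱼ as (or, or, and, and).  Each of
-- the four combinations occurs once, and each is an instance of
-- distributivity in the two-element Boolean algebra.

module Submission where

open import Defs
open import Data.Vec using ([]; _∷_)
open import Relation.Binary.PropositionalEquality
  using (_≡_; refl; cong; cong₂; module ≡-Reasoning)

infixl 7 _⊓_
infixl 6 _⊔_

_⊔_ : V → V → V
_⊔_ = juxtapose

-- The De Morgan form of Boolean "and". It is the literal normal shape of the "and" coordinates of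
-- `_∨ᵢ_` and `_∧ⱼ_`, which therefore need only `refl`.
_⊓_ : V → V → V
x ⊓ y = cross (cross x ⊔ cross y)

cross-involutive : ∀ x → cross (cross x) ≡ x
cross-involutive marked   = refl
cross-involutive unmarked = refl

⊓-distribˡ-⊔ : ∀ x y z → x ⊓ (y ⊔ z) ≡ x ⊓ y ⊔ x ⊓ z
⊓-distribˡ-⊔ unmarked _        _ = refl
-- `marked ⊓ y` computes only to `cross (cross y)`, so `y` must be split as well; `unmarked ⊔ y`
-- already computes to `y`.
⊓-distribˡ-⊔ marked   marked   _ = refl
⊓-distribˡ-⊔ marked   unmarked _ = refl

⊔-distribˡ-⊓ : ∀ x y z → x ⊔ y ⊓ z ≡ (x ⊔ y) ⊓ (x ⊔ z)
⊔-distribˡ-⊓ marked   _ _ = refl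
⊔-distribˡ-⊓ unmarked _ _ = refl

⊔-distribˡ-⊔ : ∀ x y z → x ⊔ (y ⊔ z) ≡ (x ⊔ y) ⊔ (x ⊔ z)
⊔-distribˡ-⊔ marked   _ _ = refl
⊔-distribˡ-⊔ unmarked _ _ = refl

⊓-distribˡ-⊓ : ∀ x y z → x ⊓ (y ⊓ z) ≡ (x ⊓ y) ⊓ (x ⊓ z)
⊓-distribˡ-⊓ unmarked _        _ = refl
⊓-distribˡ-⊓ marked   marked   _ = refl
⊓-distribˡ-⊓ marked   unmarked _ = refl

tuple-cong : ∀ {a a′ b b′ c c′ d d′ : V} →
             a ≡ a′ → b ≡ b′ → c ≡ c′ → d ≡ d′ →
             _≡_ {A = V⁴} (a ∷ b ∷ c ∷ d ∷ []) (a′ ∷ b′ ∷ c′ ∷ d′ ∷ [])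
tuple-cong refl refl refl refl = refl

-- `I` cubed gives `cross (cross b) ∷ cross a ∷ cross d ∷ cross (cross c) ∷
-- []`. The outer `I` swaps within each pair and crosses the `a` and `d` entries, completing De Morgan there; `b` and `c`
-- keep a double crossing on each argument.
∨ᵢ-coordinates : ∀ a b c d a′ b′ c′ d′ →
  (a ∷ b ∷ c ∷ d ∷ []) ∨ᵢ (a′ ∷ b′ ∷ c′ ∷ d′ ∷ []) ≡
  a ⊓ a′ ∷ b ⊔ b′ ∷ c ⊔ c′ ∷ d ⊓ d′ ∷ []
∨ᵢ-coordinates a b c d a′ b′ c′ d′ = tuple-cong
  refl
  (cong₂ _⊔_ (cross-involutive b) (cross-involutive b′))
  (cong₂ _⊔_ (cross-involutive c) (cross-involutive c′))
  refl

-- Here the cube is applied after juxtaposing, so the double crossing surrounds the whole of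
-- `a ⊔ a′` and `b ⊔ b′`.
∧ⱼ-coordinates : ∀ a b c d a′ b′ c′ d′ →
  (a ∷ b ∷ c ∷ d ∷ []) ∧ⱼ (a′ ∷ b′ ∷ c′ ∷ d′ ∷ []) ≡
  a ⊔ a′ ∷ b ⊔ b′ ∷ c ⊓ c′ ∷ d ⊓ d′ ∷ []
∧ⱼ-coordinates a b c d a′ b′ c′ d′ = tuple-cong
  (cross-involutive (a ⊔ a′))
  (cross-involutive (b ⊔ b′))
  refl
  refl

mainTheorem3 : (A B C : V⁴) → A ∨ᵢ (B ∧ⱼ C) ≡ (A ∨ᵢ B) ∧ⱼ (A ∨ᵢ C)
mainTheorem3 A@(a₁ ∷ a₂ ∷ a₃ ∷ a₄ ∷ [])
             B@(b₁ ∷ b₂ ∷ b₃ ∷ b₄ ∷ [])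
             C@(c₁ ∷ c₂ ∷ c₃ ∷ c₄ ∷ []) = begin
  A ∨ᵢ (B ∧ⱼ C)
    ≡⟨ cong (A ∨ᵢ_) (∧ⱼ-coordinates b₁ b₂ b₃ b₄ c₁ c₂ c₃ c₄) ⟩
  A ∨ᵢ (b₁ ⊔ c₁ ∷ b₂ ⊔ c₂ ∷ b₃ ⊓ c₃ ∷ b₄ ⊓ c₄ ∷ [])
    ≡⟨ ∨ᵢ-coordinates a₁ a₂ a₃ a₄ _ _ _ _ ⟩
  a₁ ⊓ (b₁ ⊔ c₁) ∷ a₂ ⊔ (b₂ ⊔ c₂) ∷ a₃ ⊔ b₃ ⊓ c₃ ∷ a₄ ⊓ (b₄ ⊓ c₄) ∷ []
    -- Distributivity enters only here; the steps on either side translate to and from coordinates.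
    ≡⟨ tuple-cong (⊓-distribˡ-⊔ a₁ b₁ c₁) (⊔-distribˡ-⊔ a₂ b₂ c₂)
                  (⊔-distribˡ-⊓ a₃ b₃ c₃) (⊓-distribˡ-⊓ a₄ b₄ c₄) ⟩
  a₁ ⊓ b₁ ⊔ a₁ ⊓ c₁ ∷ (a₂ ⊔ b₂) ⊔ (a₂ ⊔ c₂) ∷
  (a₃ ⊔ b₃) ⊓ (a₃ ⊔ c₃) ∷ (a₄ ⊓ b₄) ⊓ (a₄ ⊓ c₄) ∷ []
    ≡⟨ ∧ⱼ-coordinates (a₁ ⊓ b₁) (a₂ ⊔ b₂) (a₃ ⊔ b₃) (a₄ ⊓ b₄)
                      (a₁ ⊓ c₁) (a₂ ⊔ c₂) (a₃ ⊔ c₃) (a₄ ⊓ c₄) ⟨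
  (a₁ ⊓ b₁ ∷ a₂ ⊔ b₂ ∷ a₃ ⊔ b₃ ∷ a₄ ⊓ b₄ ∷ []) ∧ⱼ
  (a₁ ⊓ c₁ ∷ a₂ ⊔ c₂ ∷ a₃ ⊔ c₃ ∷ a₄ ⊓ c₄ ∷ [])
    ≡⟨ cong₂ _∧ⱼ_ (∨ᵢ-coordinates a₁ a₂ a₃ a₄ b₁ b₂ b₃ b₄)
                  (∨ᵢ-coordinates a₁ a₂ a₃ a₄ c₁ c₂ c₃ c₄) ⟨
  (A ∨ᵢ B) ∧ⱼ (A ∨ᵢ C)
    ∎
  where open ≡-Reasoning
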